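{- Let $f(x_1,\dots,x_n)$ be a reduced Boolean function with zero matrix $M_f$ (with $k$ rows) and a distinguished test $T$ formed by some columns of $M_f$, and let $D_T$ be a DNF of the Boolean function (in the test variables) whose set of zeros is the set of rows of $T$. Suppose there exists a set $\mathbb{C}$ of frames, all built over the common test $T$, which together contain all external literals. Then $f$ is realized by the DNF $$D=D_T\vee\bigvee_{C_T\in\mathbb{C}}\ \bigvee_{e\in E(C_T)}K[e].$$
   Context: Zero matrix: for $f:\{0,1\}^n\to\{0,1\}$ with exactly $k$ zeros, $M_f$ is the $k\times n$ $0/1$ matrix whose rows are the distinct zeros of $f$. $f$ is reduced if $M_f$ has no all-zero or all-one column, no two equal columns, and no column equal to the complement of another. A test is a matrix with pairwise distinct rows; $T$ consists of some columns of $M_f$ (with all $k$ rows) and is a test. Literals $x_i^{1}=x_i$, $x_i^{0}=\bar x_i$; $x_i$ is associated with column $i$ of $M_f$, $\bar x_i$ with its complement. Literals of columns in $T$ are test literals, the others external. $\mathbb{I}_k$ is the all-ones vector of length $k$. Literals $\ell_1,\dots,\ell_s$ form an orthogonal decomposition of $\mathbb{I}_k$ if their associated vectors satisfy $\ell_1\oplus\dots\oplus\ell_s=\mathbb{I}_k$ and $\ell_1\vee\dots\vee\ell_s=\mathbb{I}_k$. The connection hypergraph $H_T$ has as vertices all $2n$ literals; its edges are the pairs $\{x_i,\bar x_i\}$ (the only 2-element edges) and every set of literals forming an orthogonal decomposition of $\mathbb{I}_k$. Size of an edge = number of its vertices; edges are adjacent if they share a vertex; a root edge contains exactly one external literal.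 For a hypergraph $S$ obtained from $H_T$ by deleting some vertices and edges, a path between external literals is a sequence of external literals in which consecutive ones lie in a common edge of $S$. $S$ is a sequence of orthogonal decompositions of $\mathbb{I}_k$ if: (1) each external literal $x_i^{\sigma_i}$ that is a vertex of $S$ lies in exactly two edges of $S$, one being $\{x_i,\bar x_i\}$; (2) each external vertex lies on a path whose initial and terminal literals lie in root edges; (3) every edge adjacent to an edge of size $2$ has size $\ge 3$ or is a root edge. A frame built over $T$ is a hypergraph $C_T$ obtained as the union (of vertex sets and of edge sets, duplicate edges removed) of finitely many sequences of orthogonal decompositions $S_T^1,\dots,S_T^m$ built over $T$, provided $C_T$ contains all external vertices. $E(C_T)$ is its edge set. For $e=\{x_{i_1}^{\sigma_{i_1}},\dots,x_{i_s}^{\sigma_{i_s}}\}$, $K[e]=x_{i_1}^{\sigma_{i_1}\oplus1}\cdots x_{i_s}^{\sigma_{i_s}\oplus1}$. A DNF realizes $f$ if it equals $f$ as a Boolean function. -}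

module Defs where

open import Data.Bool using (Bool; true; false; not; if_then_else_)
open import Data.Nat using (ℕ; zero; suc; _≤_)
open import Data.Fin using (Fin)
open import Data.Vec using (Vec; lookup; replicate; _[_]≔_)
open import Data.List using (List; []; _∷_; [_]; _++_; concatMap; map; length; allFin)
open import Data.Bool.ListAction using (all; any)
open import Data.List.NonEmpty using (List⁺; toList; head; last)
open import Data.List.Relation.Unary.All using (All)
open import Data.List.Relation.Unary.Any using (Any)
open import Data.List.Relation.Unary.Linked using (Linked)
open import Data.List.Relation.Unary.Unique.Propositional using (Unique)
open import Data.List.Membership.Propositional using (_∈_)
open import Data.Product using (Σ; ∃; ∃-syntax; _×_; _,_; proj₁; proj₂)
open import Data.Sum using (_⊎_)
open import Relation.Binary.PropositionalEquality using (_≡_; _≢_)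
open import Relation.Nullary using (¬_)

count : ∀ {A : Set} → (A → Bool) → List A → ℕ
count p [] = 0
count p (x ∷ xs) = if p x then suc (count p xs) else count p xs

-- literal x_j^σ  (σ = true : x_j,  σ = false : ¬x_j)
Lit : ℕ → Set
Lit n = Fin n × Bool

litVal : ∀ {n} → Lit n → Vec Bool n → Bool
litVal (j , σ) a = if σ then lookup a j else not (lookup a j)

Term : ℕ → Set
Term n = List (Lit n)

DNF : ℕ → Set
DNF n = List (Term n)

evalTerm : ∀ {n} → Term n → Vec Bool n → Bool
evalTerm t a = all (λ ℓ → litVal ℓ a) t

evalDNF : ∀ {n} → DNF n → Vec Bool n → Bool
evalDNF D a = any (λ t → evalTerm t a) D

-- Sets of literals (vertex sets / edges): at column j, the pair
-- (contains x_j , contains ¬x_j).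

LitSet : ℕ → Set
LitSet n = Vec (Bool × Bool) n

_∈ₗ_ : ∀ {n} → Lit n → LitSet n → Bool
(j , σ) ∈ₗ e = if σ then proj₁ (lookup e j) else proj₂ (lookup e j)

lits : ∀ {n} → LitSet n → List (Lit n)
lits {n} e = concatMap
  (λ j → (if proj₁ (lookup e j) then [ (j , true) ] else [])
      ++ (if proj₂ (lookup e j) then [ (j , false) ] else []))
  (allFin n)

size : ∀ {n} → LitSet n → ℕ
size e = length (lits e)

pairE : ∀ {n} → Fin n → LitSet n
pairE {n} j = replicate n (false , false) [ j ]≔ (true , true)

K : ∀ {n} → LitSet n → Term n
K e = map (λ ℓ → (proj₁ ℓ , not (proj₂ ℓ))) (lits e)

IsZeroMatrix : ∀ {k n} → (Vec Bool n → Bool) → (Fin k → Vec Bool n) → Set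
IsZeroMatrix {k} {n} f M =
  (∀ i i' → M i ≡ M i' → i ≡ i')
  × (∀ i → f (M i) ≡ false)
  × (∀ a → f a ≡ false → ∃[ i ] M i ≡ a)

col : ∀ {k n} → (Fin k → Vec Bool n) → Fin n → Fin k → Bool
col M j i = lookup (M i) j

Reduced : ∀ {k n} → (Fin k → Vec Bool n) → Set
Reduced {k} {n} M =
  (∀ j → ¬ (∀ i → col M j i ≡ false))
  × (∀ j → ¬ (∀ i → col M j i ≡ true))
  × (∀ j j' → j ≢ j' → ¬ (∀ i → col M j i ≡ col M j' i))
  × (∀ j j' → ¬ (∀ i → col M j i ≡ not (col M j' i)))

-- T ⊆ columns (lookup T j ≡ true iff column j is in T) is a test:
-- the rows of M restricted to T are pairwise distinct.
IsTest : ∀ {k n} → (Fin k → Vec Bool n) → Vec Bool n → Set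
IsTest {k} {n} M T =
  ∀ i i' → (∀ j → lookup T j ≡ true → lookup (M i) j ≡ lookup (M i') j) → i ≡ i'

module _ {k n : ℕ} (M : Fin k → Vec Bool n) (T : Vec Bool n) where

  External : Lit n → Set
  External ℓ = lookup T (proj₁ ℓ) ≡ false

  isExt : Lit n → Bool
  isExt ℓ = not (lookup T (proj₁ ℓ))

  IsTestDNF : DNF n → Set
  IsTestDNF DT =
    All (All (λ ℓ → lookup T (proj₁ ℓ) ≡ true)) DT
    × (∀ a → evalDNF DT a ≡ false →
         ∃[ i ] (∀ j → lookup T j ≡ true → lookup a j ≡ lookup (M i) j))
    × (∀ a i → (∀ j → lookup T j ≡ true → lookup a j ≡ lookup (M i) j) →
         evalDNF DT a ≡ false)

  OrthDec : LitSet n → Set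
  OrthDec e = ∀ i → count (λ ℓ → litVal ℓ (M i)) (lits e) ≡ 1

  HEdge : LitSet n → Set
  HEdge e = (∃[ j ] e ≡ pairE j) ⊎ OrthDec e

  IsRoot : LitSet n → Set
  IsRoot e = count isExt (lits e) ≡ 1

  CommonEdge : List (LitSet n) → Lit n → Lit n → Set
  CommonEdge E x y = ∃[ e ] (e ∈ E × x ∈ₗ e ≡ true × y ∈ₗ e ≡ true)

  InRoot : List (LitSet n) → Lit n → Set
  InRoot E x = ∃[ e ] (e ∈ E × IsRoot e × x ∈ₗ e ≡ true)

  record SeqOD : Set where
    field
      V      : LitSet n
      E      : List (LitSet n)
      uniq   : Unique E
      edgesH : All HEdge E
      edgesV : All (λ e → ∀ ℓ → ℓ ∈ₗ e ≡ true → ℓ ∈ₗ V ≡ true) E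
      cond1  : ∀ ℓ → External ℓ → ℓ ∈ₗ V ≡ true →
                 pairE (proj₁ ℓ) ∈ E × count (λ e → ℓ ∈ₗ e) E ≡ 2
      cond2  : ∀ ℓ → External ℓ → ℓ ∈ₗ V ≡ true →
                 Σ (List⁺ (Lit n)) λ p →
                   ℓ ∈ toList p
                   × All (λ x → External x × x ∈ₗ V ≡ true) (toList p)
                   × Linked (CommonEdge E) (toList p)
                   × InRoot E (head p)
                   × InRoot E (last p)
      cond3  : ∀ e e' → e ∈ E → e' ∈ E → size e ≡ 2 → e' ≢ e →
                 (∃[ ℓ ] (ℓ ∈ₗ e ≡ true × ℓ ∈ₗ e' ≡ true)) →
                 (3 ≤ size e') ⊎ IsRoot e'

  open SeqOD public

  record Frame : Set where
    field
      seqs   : List SeqOD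
      covers : ∀ ℓ → External ℓ → Any (λ S → ℓ ∈ₗ V S ≡ true) seqs

  open Frame public

  frameEdges : Frame → List (LitSet n)
  frameEdges C = concatMap E (seqs C)

  CoverExternal : List Frame → Set
  CoverExternal ℂ =
    ∀ ℓ → External ℓ → Any (λ C → Any (λ S → ℓ ∈ₗ V S ≡ true) (seqs C)) ℂ

  bigD : DNF n → List Frame → DNF n
  bigD DT ℂ = DT ++ concatMap (λ C → map K (frameEdges C)) ℂ

-- Soundness: every edge e of the connection hypergraph contains a literal
-- true on a given row of M_f (a pair edge trivially, an orthogonal
-- decomposition by definition), so K[e] vanishes on every zero of f, and so
-- does D_T.  Completeness: if f(a) = 1 and D_T(a) = 0, then a agrees with
-- some row b on the test columns but a ≠ b, so a literal ℓ is true at b and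
-- false at a.  Such ℓ is external, hence by condition (1) lies in an
-- orthogonal decomposition e ≠ {ℓ, ¬ℓ} of a frame.  Either K[e](a) = 1, or
-- some m ∈ e is true at a; then ¬m separates b from a as well and, by
-- reducedness, vanishes on strictly fewer rows than ℓ, so the descent ends.
module Submission where

open import Defs
open import Data.Bool using (Bool; true; false; not; if_then_else_)
open import Data.Bool.Properties using (not-involutive; not-injective; ¬-not; not-¬; T-≡)
  renaming (_≟_ to _≟B_)
open import Data.Nat using (ℕ; suc; _≤_; _<_; z≤n; s≤s)
open import Data.Nat.Properties using (m≤n⇒m≤1+n; <-≤-trans; ≤-refl; suc-injective)
open import Data.Fin using (Fin)
open import Data.Fin.Properties using (any?) renaming (_≟_ to _≟F_)
open import Data.Vec using (Vec; lookup; replicate)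
open import Data.Vec.Properties using (lookup∘update; lookup∘update′; lookup-replicate; tabulate∘lookup; tabulate-cong)
open import Data.List using (List; []; _∷_; [_]; _++_; concatMap; map; allFin)
open import Data.Bool.ListAction using (all; any)
open import Data.List.Relation.Unary.Any using (Any; here; there)
import Data.List.Relation.Unary.Any as Any
import Data.List.Relation.Unary.All as All
open import Data.List.Relation.Unary.Any.Properties using (any⁺; any⁻)
open import Data.List.Relation.Unary.All.Properties using (all⁺; all⁻)
open import Data.List.Relation.Unary.AllPairs.Core using (_∷_)
open import Data.List.Relation.Unary.Unique.Propositional using (Unique)
open import Data.List.Membership.Propositional using (_∈_; find; lose)
open import Data.List.Membership.Propositional.Properties
  using (∈-map⁺; ∈-map⁻; ∈-++⁺ʳ; ∈-++⁺ˡ; ∈-++⁻; ∈-concatMap⁺; ∈-concatMap⁻; ∈-allFin)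
open import Data.Product using (∃-syntax; _×_; _,_; proj₁; proj₂)
open import Data.Sum using (_⊎_; inj₁; inj₂)
open import Data.Empty using (⊥-elim)
open import Function using (Equivalence)
open import Relation.Nullary using (¬_; yes; no)
open import Relation.Nullary.Decidable using (_×-dec_; ¬?; decidable-stable)
open import Relation.Binary.PropositionalEquality using (_≡_; _≢_; refl; sym; trans; cong; cong₂; subst)

open Equivalence using (to; from)

true≢false : true ≢ false
true≢false ()

module _ {A : Set} (p : A → Bool) where

  any-true⁺ : ∀ {xs x} → x ∈ xs → p x ≡ true → any p xs ≡ true
  any-true⁺ x∈ px = to T-≡ (any⁺ p (lose x∈ (from T-≡ px)))

  any-true⁻ : ∀ xs → any p xs ≡ true → ∃[ x ] (x ∈ xs × p x ≡ true)
  any-true⁻ xs h = let x , x∈ , px = find (any⁻ p xs (from T-≡ h)) in x , x∈ , to T-≡ px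

  any-false⁺ : ∀ xs → (∀ x → x ∈ xs → p x ≡ false) → any p xs ≡ false
  any-false⁺ xs h = ¬-not λ anyTrue →
    let x , x∈ , px = any-true⁻ xs anyTrue in true≢false (trans (sym px) (h x x∈))

  any-false⁻ : ∀ {xs x} → any p xs ≡ false → x ∈ xs → p x ≡ false
  any-false⁻ h x∈ = ¬-not λ px → true≢false (trans (sym (any-true⁺ x∈ px)) h)

  all-true⁺ : ∀ xs → (∀ x → x ∈ xs → p x ≡ true) → all p xs ≡ true
  all-true⁺ xs h = to T-≡ (all⁻ p (All.tabulate λ {x} x∈ → from T-≡ (h x x∈)))

  all-false⁺ : ∀ {xs x} → x ∈ xs → p x ≡ false → all p xs ≡ false
  all-false⁺ {xs} x∈ px = ¬-not λ allTrue →
    true≢false (trans (sym (to T-≡ (All.lookup (all⁺ p xs (from T-≡ allTrue)) x∈))) px)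

module _ {A : Set} (p : A → Bool) where

  count-witness : ∀ xs → 1 ≤ count p xs → ∃[ x ] (x ∈ xs × p x ≡ true)
  count-witness (y ∷ ys) h with p y in py
  ... | true = y , here refl , py
  ... | false = let x , x∈ , px = count-witness ys h in x , there x∈ , px

  count-≥1 : ∀ {xs x} → x ∈ xs → p x ≡ true → 1 ≤ count p xs
  count-≥1 (here refl) px rewrite px = s≤s z≤n
  count-≥1 {y ∷ _} (there x∈) px with p y
  ... | true = s≤s z≤n
  ... | false = count-≥1 x∈ px

  count-≥2 : ∀ {xs x y} → x ∈ xs → y ∈ xs → x ≢ y → p x ≡ true → p y ≡ true → 2 ≤ count p xs
  count-≥2 (here refl) (here refl) x≢y px py = ⊥-elim (x≢y refl)
  count-≥2 (here refl) (there y∈) x≢y px py rewrite px = s≤s (count-≥1 y∈ py)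
  count-≥2 (there x∈) (here refl) x≢y px py rewrite py = s≤s (count-≥1 x∈ px)
  count-≥2 {z ∷ _} (there x∈) (there y∈) x≢y px py with p z
  ... | true = m≤n⇒m≤1+n (count-≥2 x∈ y∈ x≢y px py)
  ... | false = count-≥2 x∈ y∈ x≢y px py

  count-partner : ∀ {xs x} → Unique xs → x ∈ xs → p x ≡ true → count p xs ≡ 2 →
    ∃[ y ] (y ∈ xs × y ≢ x × p y ≡ true)
  count-partner {z ∷ zs} (z∉zs ∷ _) (here refl) px c rewrite px =
    let y , y∈ , py = count-witness zs (subst (1 ≤_) (sym (suc-injective c)) ≤-refl)
    in y , there y∈ , (λ y≡z → All.lookup z∉zs y∈ (sym y≡z)) , py
  count-partner {z ∷ _} (z∉zs ∷ u) (there x∈) px c with p z in pz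
  ... | true = z , here refl , All.lookup z∉zs x∈ , pz
  ... | false = let y , y∈ , y≢x , py = count-partner u x∈ px c in y , there y∈ , y≢x , py

module _ {A : Set} (p q : A → Bool) (p⇒q : ∀ x → p x ≡ true → q x ≡ true) where

  count-mono : ∀ xs → count p xs ≤ count q xs
  count-mono [] = z≤n
  count-mono (x ∷ xs) with p x in px | q x in qx
  ... | true | true = s≤s (count-mono xs)
  ... | true | false = ⊥-elim (true≢false (trans (sym (p⇒q x px)) qx))
  ... | false | true = m≤n⇒m≤1+n (count-mono xs)
  ... | false | false = count-mono xs

  count-strict : ∀ {xs x} → x ∈ xs → p x ≡ false → q x ≡ true → count p xs < count q xs
  count-strict {_ ∷ xs} (here refl) px qx rewrite px | qx = s≤s (count-mono xs)
  count-strict {y ∷ _} (there x∈) px qx with p y in py | q y in qy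
  ... | true | true = s≤s (count-strict x∈ px qx)
  ... | true | false = ⊥-elim (true≢false (trans (sym (p⇒q y py)) qy))
  ... | false | true = m≤n⇒m≤1+n (count-strict x∈ px qx)
  ... | false | false = count-strict x∈ px qx

negL : ∀ {n} → Lit n → Lit n
negL ℓ = (proj₁ ℓ , not (proj₂ ℓ))

litVal-negL : ∀ {n} (ℓ : Lit n) v → litVal (negL ℓ) v ≡ not (litVal ℓ v)
litVal-negL (j , true) v = refl
litVal-negL (j , false) v = sym (not-involutive _)

litVal-true : ∀ {n} (v : Vec Bool n) j σ → lookup v j ≡ σ → litVal (j , σ) v ≡ true
litVal-true v j true v≡σ = v≡σ
litVal-true v j false v≡σ = cong not v≡σ

litVal-false : ∀ {n} (v : Vec Bool n) j σ → lookup v j ≢ σ → litVal (j , σ) v ≡ false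
litVal-false v j true v≢σ = ¬-not v≢σ
litVal-false v j false v≢σ = cong not (¬-not v≢σ)

litVal-cong : ∀ {n} (ℓ : Lit n) u v → lookup u (proj₁ ℓ) ≡ lookup v (proj₁ ℓ) → litVal ℓ u ≡ litVal ℓ v
litVal-cong (j , σ) u v u≡v rewrite u≡v = refl

columnLits : ∀ {n} → Fin n → Bool × Bool → List (Lit n)
columnLits j (b₁ , b₂) = (if b₁ then [ (j , true) ] else []) ++ (if b₂ then [ (j , false) ] else [])

columnLits-sound : ∀ {n} (j j' : Fin n) σ b₁ b₂ → (j' , σ) ∈ columnLits j (b₁ , b₂) →
  j' ≡ j × (if σ then b₁ else b₂) ≡ true
columnLits-sound j j' σ true b₂ (here refl) = refl , refl
columnLits-sound j j' σ true true (there (here refl)) = refl , refl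
columnLits-sound j j' σ false true (here refl) = refl , refl

columnLits-complete : ∀ {n} (j : Fin n) σ (p : Bool × Bool) → (if σ then proj₁ p else proj₂ p) ≡ true →
  (j , σ) ∈ columnLits j p
columnLits-complete j true (true , b₂) _ = here refl
columnLits-complete j false (b₁ , true) _ = ∈-++⁺ʳ (if b₁ then [ (j , true) ] else []) (here refl)

lits-sound : ∀ {n} (e : LitSet n) ℓ → ℓ ∈ lits e → ℓ ∈ₗ e ≡ true
lits-sound {n} e (j' , σ) ℓ∈ =
  let j , _ , ℓ∈col = find (∈-concatMap⁻ (λ j → columnLits j (lookup e j)) {xs = allFin n} ℓ∈)
  in sameColumn (columnLits-sound j j' σ (proj₁ (lookup e j)) (proj₂ (lookup e j)) ℓ∈col)
  where
  sameColumn : ∀ {j} → j' ≡ j × (if σ then proj₁ (lookup e j) else proj₂ (lookup e j)) ≡ true →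
    (j' , σ) ∈ₗ e ≡ true
  sameColumn (refl , h) = h

lits-complete : ∀ {n} (e : LitSet n) ℓ → ℓ ∈ₗ e ≡ true → ℓ ∈ lits e
lits-complete e (j , σ) h =
  ∈-concatMap⁺ (λ j → columnLits j (lookup e j)) (lose (∈-allFin j) (columnLits-complete j σ (lookup e j) h))

vec-ext : ∀ {A : Set} {n} (xs ys : Vec A n) → (∀ j → lookup xs j ≡ lookup ys j) → xs ≡ ys
vec-ext xs ys h = trans (sym (tabulate∘lookup xs)) (trans (tabulate-cong h) (tabulate∘lookup ys))

pairE-at : ∀ {n} (j : Fin n) → lookup (pairE j) j ≡ (true , true)
pairE-at {n} j = lookup∘update j (replicate n (false , false)) (true , true)

pairE-off : ∀ {n} {j j' : Fin n} → j ≢ j' → lookup (pairE j) j' ≡ (false , false)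
pairE-off {n} {j} {j'} j≢j' =
  trans (lookup∘update′ (λ j'≡j → j≢j' (sym j'≡j)) (replicate n (false , false)) (true , true))
        (lookup-replicate j' (false , false))

∈-pairE : ∀ {n} (j : Fin n) σ → (j , σ) ∈ₗ pairE j ≡ true
∈-pairE j true rewrite pairE-at j = refl
∈-pairE j false rewrite pairE-at j = refl

∈-pairE⁻ : ∀ {n} (ℓ : Lit n) j' → ℓ ∈ₗ pairE j' ≡ true → proj₁ ℓ ≡ j'
∈-pairE⁻ (j , σ) j' h with j' ≟F j
... | yes j'≡j = sym j'≡j
... | no j'≢j = ⊥-elim (true≢false (trans (sym h) (absent σ)))
  where
  absent : ∀ σ → (j , σ) ∈ₗ pairE j' ≡ false
  absent true rewrite pairE-off j'≢j = refl
  absent false rewrite pairE-off j'≢j = refl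

bothSigns : ∀ {n} (e : LitSet n) ℓ → ℓ ∈ₗ e ≡ true → negL ℓ ∈ₗ e ≡ true →
  (proj₁ ℓ , true) ∈ₗ e ≡ true × (proj₁ ℓ , false) ∈ₗ e ≡ true
bothSigns e (j , true) ℓ∈ ¬ℓ∈ = ℓ∈ , ¬ℓ∈
bothSigns e (j , false) ℓ∈ ¬ℓ∈ = ¬ℓ∈ , ℓ∈

module Edges {k n : ℕ} (M : Fin k → Vec Bool n) (T : Vec Bool n) where

  orth-someTrue : ∀ e → OrthDec M T e → ∀ r → ∃[ ℓ ] (ℓ ∈ₗ e ≡ true × litVal ℓ (M r) ≡ true)
  orth-someTrue e od r =
    let ℓ , ℓ∈ , ℓtrue = count-witness (λ ℓ → litVal ℓ (M r)) (lits e) (subst (1 ≤_) (sym (od r)) ≤-refl)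
    in ℓ , lits-sound e ℓ ℓ∈ , ℓtrue

  orth-atMostOne : ∀ e → OrthDec M T e → ∀ r {ℓ m} → ℓ ∈ₗ e ≡ true → m ∈ₗ e ≡ true → ℓ ≢ m →
    litVal ℓ (M r) ≡ true → litVal m (M r) ≡ false
  orth-atMostOne e od r {ℓ} {m} ℓ∈ m∈ ℓ≢m ℓtrue = ¬-not λ mtrue →
    two≰one (subst (2 ≤_) (od r)
      (count-≥2 (λ ℓ → litVal ℓ (M r)) (lits-complete e ℓ ℓ∈) (lits-complete e m m∈) ℓ≢m ℓtrue mtrue))
    where
    two≰one : ¬ (2 ≤ 1)
    two≰one (s≤s ())

  edge-covers : ∀ e → HEdge M T e → ∀ r → ∃[ ℓ ] (ℓ ∈ₗ e ≡ true × litVal ℓ (M r) ≡ true)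
  edge-covers _ (inj₁ (j , refl)) r =
    (j , lookup (M r) j) , ∈-pairE j (lookup (M r) j) , litVal-true (M r) j (lookup (M r) j) refl
  edge-covers e (inj₂ od) r = orth-someTrue e od r

module ReducedMatrix {k n : ℕ} (M : Fin k → Vec Bool n) (T : Vec Bool n) (red : Reduced M) where

  open Edges M T

  noZeroColumn : ∀ j → ¬ (∀ r → col M j r ≡ false)
  noZeroColumn = proj₁ red

  noOneColumn : ∀ j → ¬ (∀ r → col M j r ≡ true)
  noOneColumn = proj₁ (proj₂ red)

  noEqual : ∀ j j' → j ≢ j' → ¬ (∀ r → col M j r ≡ col M j' r)
  noEqual = proj₁ (proj₂ (proj₂ red))

  noComplement : ∀ j j' → ¬ (∀ r → col M j r ≡ not (col M j' r))
  noComplement = proj₂ (proj₂ (proj₂ red))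

  someRowWith : ∀ j b → ∃[ r ] lookup (M r) j ≡ b
  someRowWith j b with any? (λ r → lookup (M r) j ≟B b)
  ... | yes found = found
  someRowWith j true  | no none = ⊥-elim (noZeroColumn j (λ r → ¬-not (λ h → none (r , h))))
  someRowWith j false | no none = ⊥-elim (noOneColumn j (λ r → ¬-not (λ h → none (r , h))))

  distinctColumns-notComplementary : ∀ {j j'} → j' ≢ j → ∀ σ τ →
    ¬ (∀ r → litVal (j' , τ) (M r) ≡ not (litVal (j , σ) (M r)))
  distinctColumns-notComplementary {j} {j'} j'≢j σ τ c with σ | τ
  ... | true  | true  = noComplement j' j c
  ... | false | true  = noEqual j' j j'≢j (λ r → trans (c r) (not-involutive _))
  ... | true  | false = noEqual j' j j'≢j (λ r → not-injective (c r))
  ... | false | false = noComplement j' j (λ r → not-injective (c r))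

  complement-unique : ∀ ℓ m → (∀ r → litVal m (M r) ≡ not (litVal ℓ (M r))) → m ≡ negL ℓ
  complement-unique (j , σ) (j' , τ) c with j' ≟F j
  ... | no j'≢j = ⊥-elim (distinctColumns-notComplementary j'≢j σ τ c)
  ... | yes refl = cong (j ,_) (sameColumn σ τ c)
    where
    row : Fin k
    row = proj₁ (someRowWith j true)
    sameColumn : ∀ σ τ → (∀ r → litVal (j , τ) (M r) ≡ not (litVal (j , σ) (M r))) → τ ≡ not σ
    sameColumn true  false c = refl
    sameColumn false true  c = refl
    sameColumn true  true  c = ⊥-elim (not-¬ refl (c row))
    sameColumn false false c = ⊥-elim (not-¬ refl (c row))

  -- an orthogonal decomposition containing x_j and ¬x_j is the pair edge:
  -- any further literal would be false on every row, so its column constant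
  orth-pair : ∀ e → OrthDec M T e → ∀ j → (j , true) ∈ₗ e ≡ true → (j , false) ∈ₗ e ≡ true →
    e ≡ pairE j
  orth-pair e od j pos neg = vec-ext e (pairE j) column
    where
    member : ∀ σ → (j , σ) ∈ₗ e ≡ true
    member true = pos
    member false = neg
    absent : ∀ {j'} → j ≢ j' → ∀ σ → (j' , σ) ∈ₗ e ≡ false
    absent {j'} j≢j' σ = ¬-not λ present →
      let r , rσ = someRowWith j' σ
      in true≢false (trans (sym (litVal-true (M r) j' σ rσ))
           (orth-atMostOne e od r {j , lookup (M r) j} {j' , σ} (member _) present
             (λ eq → j≢j' (cong proj₁ eq)) (litVal-true (M r) j _ refl)))
    column : ∀ j' → lookup e j' ≡ lookup (pairE j) j'
    column j' with j ≟F j'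
    ... | yes refl = trans (cong₂ _,_ pos neg) (sym (pairE-at j))
    ... | no j≢j' = trans (cong₂ _,_ (absent j≢j' true) (absent j≢j' false)) (sym (pairE-off j≢j'))

  orth-jointZero : ∀ e → OrthDec M T e → ∀ {ℓ m} → ℓ ∈ₗ e ≡ true → m ∈ₗ e ≡ true → m ≢ ℓ →
    e ≢ pairE (proj₁ ℓ) → ∃[ r ] (litVal ℓ (M r) ≡ false × litVal m (M r) ≡ false)
  orth-jointZero e od {ℓ} {m} ℓ∈ m∈ m≢ℓ e≢pair
    with any? (λ r → (litVal ℓ (M r) ≟B false) ×-dec (litVal m (M r) ≟B false))
  ... | yes found = found
  ... | no none = ⊥-elim (e≢pair (orth-pair e od (proj₁ ℓ) (proj₁ signs) (proj₂ signs)))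
    where
    complementary : ∀ r → litVal m (M r) ≡ not (litVal ℓ (M r))
    complementary r with litVal ℓ (M r) in ℓr | litVal m (M r) in mr
    ... | true  | true  = ⊥-elim (true≢false
                            (trans (sym mr) (orth-atMostOne e od r {ℓ} {m} ℓ∈ m∈ (λ eq → m≢ℓ (sym eq)) ℓr)))
    ... | true  | false = refl
    ... | false | true  = refl
    ... | false | false = ⊥-elim (none (r , ℓr , mr))
    signs : (proj₁ ℓ , true) ∈ₗ e ≡ true × (proj₁ ℓ , false) ∈ₗ e ≡ true
    signs = bothSigns e ℓ ℓ∈ (subst (λ x → x ∈ₗ e ≡ true) (complement-unique ℓ m complementary) m∈)

K-true : ∀ {n} (e : LitSet n) a → (∀ ℓ → ℓ ∈ₗ e ≡ true → litVal ℓ a ≡ false) → evalTerm (K e) a ≡ true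
K-true e a allFalse = all-true⁺ (λ ℓ → litVal ℓ a) (K e) λ x x∈ →
  let ℓ , ℓ∈ , x≡¬ℓ = ∈-map⁻ negL x∈
  in trans (cong (λ x → litVal x a) x≡¬ℓ)
       (trans (litVal-negL ℓ a) (cong not (allFalse ℓ (lits-sound e ℓ ℓ∈))))

K-false : ∀ {n} (e : LitSet n) a ℓ → ℓ ∈ₗ e ≡ true → litVal ℓ a ≡ true → evalTerm (K e) a ≡ false
K-false e a ℓ ℓ∈ ℓtrue = all-false⁺ (λ ℓ → litVal ℓ a) (∈-map⁺ negL (lits-complete e ℓ ℓ∈))
  (trans (litVal-negL ℓ a) (cong not ℓtrue))

module Frames {k n : ℕ} (M : Fin k → Vec Bool n) (T : Vec Bool n) where

  FrameEdge : List (Frame M T) → LitSet n → Set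
  FrameEdge ℂ e = Any (λ C → e ∈ frameEdges M T C) ℂ

  K∈bigD : ∀ DT ℂ {e} → FrameEdge ℂ e → K e ∈ bigD M T DT ℂ
  K∈bigD DT ℂ fe =
    let C , C∈ , e∈ = find fe
    in ∈-++⁺ʳ DT (∈-concatMap⁺ (λ C → map K (frameEdges M T C)) (lose C∈ (∈-map⁺ K e∈)))

  bigD-terms : ∀ DT ℂ {t} → t ∈ bigD M T DT ℂ → t ∈ DT ⊎ ∃[ e ] (HEdge M T e × t ≡ K e)
  bigD-terms DT ℂ t∈ with ∈-++⁻ DT t∈
  ... | inj₁ t∈DT = inj₁ t∈DT
  ... | inj₂ t∈frames =
    let C , _ , t∈C = find (∈-concatMap⁻ (λ C → map K (frameEdges M T C)) {xs = ℂ} t∈frames)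
        e , e∈ , t≡Ke = ∈-map⁻ K t∈C
        S , _ , e∈S = find (∈-concatMap⁻ E {xs = seqs C} e∈)
    in inj₂ (e , All.lookup (edgesH S) e∈S , t≡Ke)

  secondEdge : ∀ (S : SeqOD M T) ℓ → External M T ℓ → ℓ ∈ₗ V S ≡ true →
    ∃[ e ] (e ∈ E S × OrthDec M T e × e ≢ pairE (proj₁ ℓ) × ℓ ∈ₗ e ≡ true)
  secondEdge S ℓ ext ℓ∈V with cond1 S ℓ ext ℓ∈V
  ... | pair∈ , twoEdges with count-partner (λ e → ℓ ∈ₗ e) (uniq S) pair∈ (∈-pairE (proj₁ ℓ) (proj₂ ℓ)) twoEdges
  ...   | e , e∈ , e≢pair , ℓ∈e with All.lookup (edgesH S) e∈
  ...     | inj₂ od = e , e∈ , od , e≢pair , ℓ∈e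
  ...     | inj₁ (j , refl) = ⊥-elim (e≢pair (cong pairE (sym (∈-pairE⁻ ℓ j ℓ∈e))))

  frameOrthEdge : ∀ ℂ → CoverExternal M T ℂ → ∀ ℓ → External M T ℓ →
    ∃[ e ] (FrameEdge ℂ e × OrthDec M T e × e ≢ pairE (proj₁ ℓ) × ℓ ∈ₗ e ≡ true)
  frameOrthEdge ℂ cov ℓ ext =
    let C , C∈ , inC = find (cov ℓ ext)
        S , S∈ , ℓ∈V = find inC
        e , e∈ , od , e≢pair , ℓ∈e = secondEdge S ℓ ext ℓ∈V
    in e , lose C∈ (∈-concatMap⁺ E (lose S∈ e∈)) , od , e≢pair , ℓ∈e

D-vanishesOnRows : ∀ {k n} (M : Fin k → Vec Bool n) T DT → IsTestDNF M T DT →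
  ∀ ℂ i → evalDNF (bigD M T DT ℂ) (M i) ≡ false
D-vanishesOnRows M T DT testDNF ℂ i = any-false⁺ (λ t → evalTerm t (M i)) (bigD M T DT ℂ) termVanishes
  where
  open Edges M T
  open Frames M T
  DT-vanishes : evalDNF DT (M i) ≡ false
  DT-vanishes = proj₂ (proj₂ testDNF) (M i) i (λ _ _ → refl)
  termVanishes : ∀ t → t ∈ bigD M T DT ℂ → evalTerm t (M i) ≡ false
  termVanishes t t∈ with bigD-terms DT ℂ t∈
  ... | inj₁ t∈DT = any-false⁻ (λ t → evalTerm t (M i)) DT-vanishes t∈DT
  ... | inj₂ (e , edge , refl) =
    let ℓ , ℓ∈ , ℓtrue = edge-covers e edge i in K-false e (M i) ℓ ℓ∈ ℓtrue

module Descent {k n : ℕ} (M : Fin k → Vec Bool n) (T : Vec Bool n) (red : Reduced M)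
  (ℂ : List (Frame M T)) (cov : CoverExternal M T ℂ)
  (a : Vec Bool n) (i : Fin k) (agree : ∀ j → lookup T j ≡ true → lookup a j ≡ lookup (M i) j) where

  open Edges M T
  open ReducedMatrix M T red
  open Frames M T

  Separating : Lit n → Set
  Separating ℓ = litVal ℓ (M i) ≡ true × litVal ℓ a ≡ false

  -- the number of rows on which ℓ vanishes: the measure of the descent
  zeros : Lit n → ℕ
  zeros ℓ = count (λ r → not (litVal ℓ (M r))) (allFin k)

  -- a and row i agree on the test columns, so a separating literal is external
  separating⇒external : ∀ {ℓ} → Separating ℓ → External M T ℓ
  separating⇒external {ℓ} (atRow , atA) with lookup T (proj₁ ℓ) in inTest
  ... | false = refl
  ... | true = ⊥-elim (true≢false
                 (trans (sym atRow) (trans (sym (litVal-cong ℓ a (M i) (agree _ inTest))) atA)))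

  deeper : ∀ e ℓ {m} → OrthDec M T e → e ≢ pairE (proj₁ ℓ) → ℓ ∈ₗ e ≡ true → Separating ℓ →
    m ∈ₗ e ≡ true → litVal m a ≡ true → Separating (negL m) × zeros (negL m) < zeros ℓ
  deeper e ℓ {m} od e≢pair ℓ∈ (atRow , atA) m∈ mA = (sepRow , sepA) , fewerZeros
    where
    m≢ℓ : m ≢ ℓ
    m≢ℓ refl = true≢false (trans (sym mA) atA)
    exclusive : ∀ r → litVal ℓ (M r) ≡ true → litVal m (M r) ≡ false
    exclusive r = orth-atMostOne e od r {ℓ} {m} ℓ∈ m∈ (λ eq → m≢ℓ (sym eq))
    sepRow : litVal (negL m) (M i) ≡ true
    sepRow = trans (litVal-negL m (M i)) (cong not (exclusive i atRow))
    sepA : litVal (negL m) a ≡ false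
    sepA = trans (litVal-negL m a) (cong not mA)
    zerosIncluded : ∀ r → not (litVal (negL m) (M r)) ≡ true → not (litVal ℓ (M r)) ≡ true
    zerosIncluded r zero¬m with litVal ℓ (M r) in ℓr
    ... | false = refl
    ... | true = ⊥-elim (true≢false
                   (trans (sym zero¬m) (cong not (trans (litVal-negL m (M r)) (cong not (exclusive r ℓr))))))
    -- a row where ℓ and m both vanish is a zero of ℓ but not of ¬m
    fewerZeros : zeros (negL m) < zeros ℓ
    fewerZeros =
      let r , ℓ0 , m0 = orth-jointZero e od ℓ∈ m∈ m≢ℓ e≢pair
      in count-strict (λ r → not (litVal (negL m) (M r))) (λ r → not (litVal ℓ (M r))) zerosIncluded
           (∈-allFin r) (cong not (trans (litVal-negL m (M r)) (cong not m0))) (cong not ℓ0)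

  descentStep : ∀ e ℓ → OrthDec M T e → e ≢ pairE (proj₁ ℓ) → ℓ ∈ₗ e ≡ true → Separating ℓ →
    (∀ m → m ∈ₗ e ≡ true → litVal m a ≡ false) ⊎ ∃[ ℓ' ] (Separating ℓ' × zeros ℓ' < zeros ℓ)
  descentStep e ℓ od e≢pair ℓ∈ sep with Any.any? (λ m → litVal m a ≟B true) (lits e)
  ... | no none = inj₁ λ m m∈ → ¬-not λ mA → none (lose (lits-complete e m m∈) mA)
  ... | yes some =
    let m , m∈ , mA = find some
    in inj₂ (negL m , deeper e ℓ od e≢pair ℓ∈ sep (lits-sound e m m∈) mA)

  descend : ∀ d ℓ → zeros ℓ < d → Separating ℓ → ∃[ e ] (FrameEdge ℂ e × evalTerm (K e) a ≡ true)
  descend (suc d) ℓ (s≤s bound) sep with frameOrthEdge ℂ cov ℓ (separating⇒external sep)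
  ... | e , frameEdge , od , e≢pair , ℓ∈ with descentStep e ℓ od e≢pair ℓ∈ sep
  ...   | inj₁ allFalse = e , frameEdge , K-true e a allFalse
  ...   | inj₂ (ℓ' , sep' , fewer) = descend d ℓ' (<-≤-trans fewer bound) sep'

differingColumn : ∀ {n} (u v : Vec Bool n) → u ≢ v → ∃[ j ] lookup u j ≢ lookup v j
differingColumn u v u≢v with any? (λ j → ¬? (lookup u j ≟B lookup v j))
... | yes found = found
... | no none = ⊥-elim (u≢v (vec-ext u v λ j →
  decidable-stable (lookup u j ≟B lookup v j) (λ ne → none (j , ne))))

D-coversNonzeros : ∀ {k n} (f : Vec Bool n → Bool) (M : Fin k → Vec Bool n) → IsZeroMatrix f M → Reduced M →
  ∀ T DT → IsTestDNF M T DT → ∀ ℂ → CoverExternal M T ℂ →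
  ∀ a → f a ≡ true → evalDNF (bigD M T DT ℂ) a ≡ true
D-coversNonzeros f M zeroMatrix red T DT testDNF ℂ cov a fa with evalDNF DT a in DTa
... | true =
  let t , t∈ , ta = any-true⁻ (λ t → evalTerm t a) DT DTa
  in any-true⁺ (λ t → evalTerm t a) (∈-++⁺ˡ t∈) ta
... | false =
  let i , agree = proj₁ (proj₂ testDNF) a DTa
      j , aj≢ = differingColumn a (M i) (λ a≡Mi →
                  true≢false (trans (sym fa) (trans (cong f a≡Mi) (proj₁ (proj₂ zeroMatrix) i))))
      open Descent M T red ℂ cov a i agree
      ℓ₀ : Lit _
      ℓ₀ = (j , lookup (M i) j)
      e , frameEdge , Ka = descend (suc (zeros ℓ₀)) ℓ₀ ≤-refl
                             (litVal-true (M i) j _ refl , litVal-false a j _ aj≢)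
  in any-true⁺ (λ t → evalTerm t a) (Frames.K∈bigD M T DT ℂ frameEdge) Ka

-- The theorem: D = D_T ∨ ⋁_{C ∈ ℂ} ⋁_{e ∈ E(C)} K[e] realizes f.
-- (The argument does not use that T is a test.)

lemma11 : ∀ {k n} (f : Vec Bool n → Bool) (M : Fin k → Vec Bool n) →
    IsZeroMatrix f M → Reduced M →
    (T : Vec Bool n) → IsTest M T →
    (DT : DNF n) → IsTestDNF M T DT →
    (ℂ : List (Frame M T)) → CoverExternal M T ℂ →
    ∀ a → evalDNF (bigD M T DT ℂ) a ≡ f a
lemma11 f M zeroMatrix red T _ DT testDNF ℂ cov a with f a in fa
... | true = D-coversNonzeros f M zeroMatrix red T DT testDNF ℂ cov a fa
... | false =
  let i , Mi≡a = proj₂ (proj₂ zeroMatrix) a fa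
  in subst (λ v → evalDNF (bigD M T DT ℂ) v ≡ false) Mi≡a (D-vanishesOnRows M T DT testDNF ℂ i)
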